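{- Let $k\ge 0$ and $K=2k^3$. Let $\mathcal I$ be an interpretation coloured by $\kappa$ that is $K$-sparse, and let $\mathcal Q$ be a finite interpretation with $|\Delta^{\mathcal Q}|\le k$. Then $\mathcal Q$ maps homomorphically into $\mathcal I$ if and only if $\mathcal Q$ maps homomorphically into the quotient $\mathcal I/{\sim_K}$.
   Context: Homomorphisms are maps between domains preserving membership in every concept name and every role name. Distance: view $\mathcal I$ as an undirected graph with an edge between $x,y$ whenever $(x,y)$ or $(y,x)\in r^{\mathcal I}$ for some role name $r$; $d_{\mathcal I}(x,y)$ is the length of a shortest undirected path ($\infty$ if none). $N_k(x)=\{y: d_{\mathcal I}(x,y)\le k\}$, and $\mathcal I\upharpoonright N_k(x)$ is the induced subinterpretation (domain $N_k(x)$, concepts and roles restricted). A coloured interpretation is $\mathcal I$ with a partial map $\kappa\colon\mathrm{dom}(\kappa)\to C$, $\mathrm{dom}(\kappa)\subseteq\Delta^{\mathcal I}$, $C$ a set of colours; subinterpretations are coloured by the restriction of $\kappa$. A homomorphism $h$ from $\mathcal I$ (coloured by $\kappa$) to $\mathcal J$ (coloured by $\theta$) preserves colours if for all $x$: $x\in\mathrm{dom}(\kappa)\iff h(x)\in\mathrm{dom}(\theta)$, and then $\kappa(x)=\theta(h(x))$. $x\sim_k y$ iff $x=y$, or $x,y\in\mathrm{dom}(\kappa)$, $\kappa(x)=\kappa(y)$, and there are colour-preserving homomorphisms $\mathcal I\upharpoonright N_k(x)\to\mathcal I\upharpoonright N_k(y)$ mapping $x$ to $y$ and $\mathcal I\upharpoonright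 N_k(y)\to\mathcal I\upharpoonright N_k(x)$ mapping $y$ to $x$. $\mathcal I$ is $k$-sparse if for every $x$ and distinct $y,y'\in N_k(x)\cap\mathrm{dom}(\kappa)$ we have $\kappa(y)\ne\kappa(y')$. For an equivalence relation $\sim$ on $\Delta^{\mathcal I}$, the quotient $\mathcal I/{\sim}$ has domain the classes $[x]_\sim$, $A^{\mathcal I/\sim}=\{[x]_\sim: x\in A^{\mathcal I}\}$ and $r^{\mathcal I/\sim}=\{([x]_\sim,[y]_\sim):(x,y)\in r^{\mathcal I}\}$. -}

module Defs where

open import Level using (Level; suc)
open import Data.Fin.Base using (Fin)
open import Data.Maybe.Base using (Maybe)
open import Data.Maybe using (Is-just)
open import Data.Nat.Base using (ℕ; _≤_; z≤n) renaming (suc to 1+_)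
open import Data.Product.Base using (Σ; Σ-syntax; ∃-syntax; _×_; _,_; proj₁; proj₂)
open import Data.Sum.Base using (_⊎_; inj₁; inj₂)
open import Function.Base using (id; _∘_; _on_)
open import Function.Bundles using (Func; Inverse; Equivalence; mk⇔; _⇔_)
open import Relation.Binary.Bundles using (Setoid)
open import Relation.Binary.Construct.Closure.Symmetric using (SymClosure; fwd; bwd)
import Relation.Binary.Construct.On as On
open import Relation.Binary.Core using (Rel)
open import Relation.Binary.Definitions using (_Respects_; _Respects₂_)
open import Relation.Binary.PropositionalEquality.Core as ≡ using (_≡_; _≢_)
import Relation.Binary.PropositionalEquality.Properties as ≡
open import Relation.Binary.Structures using (IsEquivalence)
open import Relation.Nullary.Negation.Core using (¬_)
open import Relation.Unary using (Pred)

-- Domains are setoids, so that the quotient of an interpretation is again an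
-- interpretation; "equal" elements are elements related by the setoid equality.
-- NC and NR are the sets of concept names and role names.
record Interpretation {ℓ : Level} (NC NR : Set ℓ) : Set (suc ℓ) where
  field
    Δ       : Setoid ℓ ℓ
  open Setoid Δ public
  field
    concept      : NC → Pred Carrier ℓ
    role         : NR → Rel Carrier ℓ
    concept-resp : ∀ A → concept A Respects _≈_
    role-resp    : ∀ r → role r Respects₂ _≈_

module _ {ℓ : Level} {NC NR : Set ℓ} where

  record Hom (I J : Interpretation NC NR) : Set ℓ where
    private
      module I = Interpretation I
      module J = Interpretation J
    field
      func : Func I.Δ J.Δ
    open Func func public
    field
      pres-concept : ∀ A {x} → I.concept A x → J.concept A (to x)
      pres-role    : ∀ r {x y} → I.role r x y → J.role r (to x) (to y)

  -- The domain has exactly n elements up to the setoid equality.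
  HasCardinality : Interpretation NC NR → ℕ → Set ℓ
  HasCardinality I n = Inverse (≡.setoid (Fin n)) (Interpretation.Δ I)

  module _ (I : Interpretation NC NR) where
    open Interpretation I

    Adjacent : Rel Carrier ℓ
    Adjacent = SymClosure (λ x y → ∃[ r ] role r x y)

    -- Path x y n : an undirected path of length n from x to y.
    data Path : Carrier → Carrier → ℕ → Set ℓ where
      stop : ∀ {x y} → x ≈ y → Path x y 0
      step : ∀ {x y z n} → Adjacent x y → Path y z n → Path x z (1+ n)

    -- d(x,y) = n. Distance ∞ is the case where no n qualifies.
    Distance : Carrier → Carrier → ℕ → Set ℓ
    Distance x y n = Path x y n × (∀ m → Path x y m → n ≤ m)

    N : ℕ → Carrier → Pred Carrier ℓ
    N k x y = ∃[ n ] (Distance x y n × n ≤ k)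

    centre : ∀ k x → N k x x
    centre k x = 0 , (stop refl , λ _ _ → z≤n) , z≤n

  infix 8 _↾_

  _↾_ : (I : Interpretation NC NR) → Pred (Interpretation.Carrier I) ℓ → Interpretation NC NR
  I ↾ P = record
    { Δ            = On.setoid {B = Σ Carrier P} Δ proj₁
    ; concept      = λ A → concept A ∘ proj₁
    ; role         = λ r → role r on proj₁
    ; concept-resp = λ A → concept-resp A
    ; role-resp    = λ r → proj₁ (role-resp r) , proj₂ (role-resp r)
    }
    where open Interpretation I

  -- The quotient I/∼: classes are given by representatives, and equality of
  -- classes is ∼. It is meant for relations ∼ containing the equality of I.
  quotient : (I : Interpretation NC NR) (_∼_ : Rel (Interpretation.Carrier I) ℓ) →
             IsEquivalence _∼_ → Interpretation NC NR
  quotient I _∼_ isEq = record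
    { Δ            = record { isEquivalence = isEq }
    ; concept      = λ A x → ∃[ x′ ] (x ∼ x′ × concept A x′)
    ; role         = λ r x y → ∃[ x′ ] ∃[ y′ ] (x ∼ x′ × y ∼ y′ × role r x′ y′)
    ; concept-resp = λ { A x∼y (x′ , p , a) → x′ , E.trans (E.sym x∼y) p , a }
    ; role-resp    = λ r →
        (λ { y∼z (x′ , y′ , p , q , a) → x′ , y′ , p , E.trans (E.sym y∼z) q , a }) ,
        (λ { x∼z (x′ , y′ , p , q , a) → x′ , y′ , E.trans (E.sym x∼z) p , q , a })
    }
    where
    open Interpretation I using (concept; role)
    module E = IsEquivalence isEq

  -- A partial map from the domain of I to C; `nothing` means "uncoloured".
  Colouring : Interpretation NC NR → Set ℓ → Set ℓ
  Colouring I C = Func (Interpretation.Δ I) (≡.setoid (Maybe C))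

  module _ {C : Set ℓ} where

    infix 4 _∈dom_

    _∈dom_ : {S : Setoid ℓ ℓ} → Setoid.Carrier S → Func S (≡.setoid (Maybe C)) → Set ℓ
    x ∈dom κ = Is-just (Func.to κ x)

    restrict : (I : Interpretation NC NR) → Colouring I C →
               (P : Pred (Interpretation.Carrier I) ℓ) → Colouring (I ↾ P) C
    restrict I κ P = record { to = Func.to κ ∘ proj₁ ; cong = Func.cong κ }

    PreservesColours : {I J : Interpretation NC NR} →
                       Colouring I C → Colouring J C → Hom I J → Set ℓ
    PreservesColours {I} {J} κ θ h = ∀ x →
      (x ∈dom κ ⇔ Hom.to h x ∈dom θ) ×
      (x ∈dom κ → Func.to κ x ≡ Func.to θ (Hom.to h x))

    module _ (I : Interpretation NC NR) (κ : Colouring I C) where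
      open Interpretation I
      private
        κ⟨_⟩ : Carrier → Maybe C
        κ⟨_⟩ = Func.to κ

        dom : Pred Carrier ℓ
        dom x = x ∈dom κ

      Sparse : ℕ → Set ℓ
      Sparse k = ∀ x y y′ → N I k x y → N I k x y′ → dom y → dom y′ →
                 ¬ (y ≈ y′) → κ⟨ y ⟩ ≢ κ⟨ y′ ⟩

      -- A colour-preserving homomorphism I↾N_k(x) → I↾N_k(y) mapping x to y.
      NeighbourhoodMap : ℕ → Rel Carrier ℓ
      NeighbourhoodMap k x y =
        Σ[ h ∈ Hom (I ↾ N I k x) (I ↾ N I k y) ]
          PreservesColours (restrict I κ (N I k x)) (restrict I κ (N I k y)) h ×
          proj₁ (Hom.to h (x , centre I k x)) ≈ y

      Sim : ℕ → Rel Carrier ℓ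
      Sim k x y =
        x ≈ y ⊎
        (dom x × dom y × κ⟨ x ⟩ ≡ κ⟨ y ⟩ × NeighbourhoodMap k x y × NeighbourhoodMap k y x)

      private
        Path-resp : ∀ {x y z n} → x ≈ y → Path I x z n → Path I y z n
        Path-resp p (stop q)            = stop (trans (sym p) q)
        Path-resp p (step (fwd (r , a)) w) = step (fwd (r , proj₂ (role-resp r) p a)) w
        Path-resp p (step (bwd (r , a)) w) = step (bwd (r , proj₁ (role-resp r) p a)) w

        N-resp : ∀ {k x y z} → x ≈ y → N I k x z → N I k y z
        N-resp p (n , (w , least) , n≤k) =
          n , (Path-resp p w , λ m v → least m (Path-resp (sym p) v)) , n≤k

        map-≈ : ∀ {k x y} → x ≈ y → NeighbourhoodMap k x y
        map-≈ p =
          record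
            { func         = record { to = λ (z , q) → z , N-resp p q ; cong = id }
            ; pres-concept = λ _ → id
            ; pres-role    = λ _ → id
            } ,
          (λ _ → mk⇔ id id , λ _ → ≡.refl) , p

        map-∘ : ∀ {k x y z} → NeighbourhoodMap k x y → NeighbourhoodMap k y z →
                NeighbourhoodMap k x z
        map-∘ (g , gc , gx) (h , hc , hy) =
          record
            { func         = record { to = h.to ∘ g.to ; cong = h.cong ∘ g.cong }
            ; pres-concept = λ A → h.pres-concept A ∘ g.pres-concept A
            ; pres-role    = λ r → h.pres-role r ∘ g.pres-role r
            } ,
          (λ v → let (gd , ge) = gc v ; (hd , he) = hc (g.to v) in
            mk⇔ (Equivalence.to hd ∘ Equivalence.to gd)
                (Equivalence.from gd ∘ Equivalence.from hd) ,
            λ d → ≡.trans (ge d) (he (Equivalence.to gd d))) ,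
          trans (h.cong gx) hy
          where
          module g = Hom g
          module h = Hom h

        dom-resp : ∀ {x y} → x ≈ y → dom x → dom y
        dom-resp p = ≡.subst Is-just (Func.cong κ p)

        Sim-sym : ∀ {k x y} → Sim k x y → Sim k y x
        Sim-sym (inj₁ p)                   = inj₁ (sym p)
        Sim-sym (inj₂ (dx , dy , e , f , g)) = inj₂ (dy , dx , ≡.sym e , g , f)

        Sim-trans : ∀ {k x y z} → Sim k x y → Sim k y z → Sim k x z
        Sim-trans (inj₁ p) (inj₁ q) = inj₁ (trans p q)
        Sim-trans (inj₁ p) (inj₂ (dy , dz , e , f , g)) =
          inj₂ (dom-resp (sym p) dy , dz , ≡.trans (Func.cong κ p) e ,
                map-∘ (map-≈ p) f , map-∘ g (map-≈ (sym p)))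
        Sim-trans (inj₂ (dx , dy , e , f , g)) (inj₁ q) =
          inj₂ (dx , dom-resp q dy , ≡.trans e (Func.cong κ q) ,
                map-∘ f (map-≈ q) , map-∘ (map-≈ (sym q)) g)
        Sim-trans (inj₂ (dx , _ , e , f , g)) (inj₂ (_ , dz , e′ , f′ , g′)) =
          inj₂ (dx , dz , ≡.trans e e′ , map-∘ f f′ , map-∘ g′ g)

      Sim-isEquivalence : ∀ k → IsEquivalence (Sim k)
      Sim-isEquivalence k = record { refl = inj₁ refl ; sym = Sim-sym ; trans = Sim-trans }

      quotient-∼ : ℕ → Interpretation NC NR
      quotient-∼ k = quotient I (Sim k) (Sim-isEquivalence k)

{-# OPTIONS --safe #-}

-- For the non-trivial direction, let h : Q → I/∼. Walking along Q from a vertex c, one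
-- transports the K-neighbourhood of h(c) step by step, losing one unit of radius
-- per edge: a vertex i at the end of a walk of length L gets an element y of I, at
-- distance at most L from h(c), with a colour-preserving homomorphism from the
-- (K − L)-neighbourhood of h(i) that sends h(i) to y. If h(i) is coloured,
-- K-sparsity makes y independent of the walk. If not, the class of h(i) is a
-- singleton, so on a connected set of uncoloured vertices (a blob) h is already
-- a homomorphism into I, and it suffices to move each blob by a single map: the one
-- obtained at a chosen vertex of the blob. Walks without repetitions have length less than k,
-- so everything happens at distance at most 2k ≤ K from h(c).

module Submission where

open import Level using (Level; _⊔_)
open import Axiom.ExcludedMiddle using (ExcludedMiddle)
open import Data.Nat.Base using (ℕ; _≤_; _*_; _^_)
open import Data.Product.Base using (∃-syntax; _×_)
open import Function.Bundles using (_⇔_)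
open import Defs
open import Data.Empty using (⊥-elim)
open import Data.Fin.Base using (Fin; zero; suc; toℕ)
open import Data.Fin.Properties using (toℕ-injective; injective⇒≤; _≟_)
open import Data.List.Base using (List; []; _∷_; length; lookup)
import Data.List.Membership.DecPropositional as DecMembership
open import Data.List.Membership.Propositional using (_∈_)
open import Data.List.Membership.Propositional.Properties using (∈-lookup)
open import Data.List.Relation.Unary.All as All using ([]; _∷_)
open import Data.List.Relation.Unary.All.Properties using (¬Any⇒All¬)
open import Data.List.Relation.Unary.Any using (here; there)
open import Data.List.Relation.Unary.AllPairs using ([]; _∷_)
open import Data.List.Relation.Unary.Unique.Propositional using (Unique)
open import Data.Maybe.Base using (just; nothing)
open import Data.Maybe.Relation.Unary.Any using (just)
open import Data.Nat.Base using (zero; suc; _+_; _<_; z≤n; s≤s)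
open import Data.Nat.Induction using (<-rec)
open import Data.Nat.Properties using
  ( ≤-refl; ≤-trans; ≤-antisym; <⇒≤; ≮⇒≥; +-comm; +-suc; +-mono-≤; +-monoˡ-≤; +-monoʳ-<
  ; m≤m+n; m+n≤o⇒m≤o; m≤m*n; m^n≢0 )
open import Data.Product.Base using (_,_; proj₁; proj₂)
open import Data.Sum.Base using (inj₁; inj₂)
open import Function.Base using (id; _∘_)
open import Function.Bundles using (Func; Inverse; Equivalence; mk⇔)
open import Relation.Binary.Construct.Closure.Equivalence using (EqClosure; isEquivalence)
import Relation.Binary.Construct.Closure.Equivalence as EqClosure
open import Relation.Binary.Construct.Closure.ReflexiveTransitive using (Star; ε; _◅_)
open import Relation.Binary.Construct.Closure.Symmetric as SymClosure using (SymClosure; fwd; bwd)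
open import Relation.Binary.Core using (Rel)
open import Relation.Binary.Structures using (IsEquivalence)
open import Relation.Binary.PropositionalEquality using (_≡_; refl; sym; trans; cong; subst)
open import Relation.Nullary.Decidable using (yes; no; decidable-stable)
open import Relation.Nullary.Negation using (¬_)

-- Walks in finite graphs and their shortening.

private
  variable
    a ℓ : Level

-- The list omits the start, so `length xs` counts edges, while `x ∷ xs` lists all visited vertices.
data Walk {A : Set a} (R : Rel A ℓ) : A → A → List A → Set (a ⊔ ℓ) where
  []  : ∀ {x} → Walk R x x []
  _∷_ : ∀ {x y z xs} → R x y → Walk R y z xs → Walk R x z (y ∷ xs)

suffix : {A : Set a} {R : Rel A ℓ} {x y z : A} {xs : List A} →
         Walk R y z xs → x ∈ y ∷ xs → Unique (y ∷ xs) →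
         ∃[ ys ] (Walk R x z ys × Unique (x ∷ ys))
suffix w       (here refl) u       = _ , w , u
suffix (_ ∷ w) (there x∈)  (_ ∷ u) = suffix w x∈ u

lookup-injective : {A : Set a} {xs : List A} → Unique xs →
                   ∀ {i j} → lookup xs i ≡ lookup xs j → i ≡ j
lookup-injective (_ ∷ _)  {zero}  {zero}  _ = refl
lookup-injective {xs = _ ∷ xs} (x∉ ∷ _) {zero} {suc j} e =
  ⊥-elim (All.lookup x∉ (∈-lookup {xs = xs} j) e)
lookup-injective {xs = _ ∷ xs} (x∉ ∷ _) {suc i} {zero} e =
  ⊥-elim (All.lookup x∉ (∈-lookup {xs = xs} i) (sym e))
lookup-injective (_ ∷ u)  {suc i} {suc j} e = cong suc (lookup-injective u e)

simple-walk : ∀ {n} {R : Rel (Fin n) ℓ} {x y} → Star R x y →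
              ∃[ xs ] (Walk R x y xs × Unique (x ∷ xs))
simple-walk ε = [] , [] , [] ∷ []
simple-walk {x = x} (_◅_ {j = z} r s) with simple-walk s
... | xs , w , u with DecMembership._∈?_ _≟_ x (z ∷ xs)
-- The vertex `x` recurs later: the loop back to it is cut off.
...   | yes x∈ = suffix w x∈ u
...   | no  x∉ = z ∷ xs , r ∷ w , ¬Any⇒All¬ (z ∷ xs) x∉ ∷ u

-- Pigeonhole: without repetitions, `lookup` embeds the `1 + length xs` positions of `x ∷ xs` into
-- `Fin n`.
short-walk : ∀ {n} {R : Rel (Fin n) ℓ} {x y} → Star R x y →
             ∃[ xs ] (Walk R x y xs × length xs < n)
short-walk s with xs , w , u ← simple-walk s = xs , w , injective⇒≤ (lookup-injective u)

-- Minima and canonical class representatives.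

-- `rep-unique` yields an equality, so data chosen at `rep i` coincide throughout a class.
record Transversal {n} (_~_ : Rel (Fin n) ℓ) : Set ℓ where
  field
    rep         : Fin n → Fin n
    rep-related : ∀ i → rep i ~ i
    rep-unique  : ∀ {i j} → i ~ j → rep i ≡ rep j

open Transversal

module _ (em : ExcludedMiddle ℓ) where

  minimum : (P : ℕ → Set ℓ) → ∀ {n} → P n →
            ∃[ m ] (m ≤ n × P m × (∀ j → P j → m ≤ j))
  minimum P {n} = <-rec (λ n → P n → ∃[ m ] (m ≤ n × P m × (∀ j → P j → m ≤ j))) go n
    where
    go : ∀ n → (∀ {m} → m < n → P m → ∃[ l ] (l ≤ m × P l × (∀ j → P j → l ≤ j))) →
         P n → ∃[ m ] (m ≤ n × P m × (∀ j → P j → m ≤ j))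
    go n rec p with em {∃[ j ] (j < n × P j)}
    ... | yes (j , j<n , q) with l , l≤j , r ← rec j<n q = l , ≤-trans l≤j (<⇒≤ j<n) , r
    ... | no ∄ = n , ≤-refl , p , λ j q → ≮⇒≥ (λ j<n → ∄ (j , j<n , q))

  -- The representative is the least number in the class; the minima of related elements bound each
  -- other, hence agree.
  transversal : ∀ {n} {_~_ : Rel (Fin n) ℓ} → IsEquivalence _~_ → Transversal _~_
  transversal {n} {_~_} isEq = record
    { rep         = least-related
    ; rep-related = λ i → E.sym (proj₂ (proj₂ (hit i)))
    ; rep-unique  = λ e → toℕ-injective (≤-antisym (below e) (below (E.sym e)))
    }
    where
    module E = IsEquivalence isEq
    Hit : Fin n → ℕ → Set ℓ
    Hit i m = ∃[ j ] (toℕ j ≡ m × i ~ j)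
    least = λ i → minimum (Hit i) (i , refl , E.refl)
    hit = λ i → proj₁ (proj₂ (proj₂ (least i)))
    least-related : Fin n → Fin n
    least-related i = proj₁ (hit i)
    below : ∀ {i j} → i ~ j → toℕ (least-related i) ≤ toℕ (least-related j)
    below {i} {j} e with j′ , eq , f ← hit j = subst (_≤ _) (sym (proj₁ (proj₂ (hit i))))
      (proj₂ (proj₂ (proj₂ (least i))) _ (j′ , refl , E.trans e f))

-- Paths and balls.

module _ {NC NR : Set ℓ} (I : Interpretation NC NR) where
  private module I = Interpretation I

  Adjacent-sym : ∀ {x y} → Adjacent I x y → Adjacent I y x
  Adjacent-sym = SymClosure.symmetric _

  Adjacent-respˡ : ∀ {x y z} → x I.≈ y → Adjacent I x z → Adjacent I y z
  Adjacent-respˡ e (fwd (r , p)) = fwd (r , proj₂ (I.role-resp r) e p)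
  Adjacent-respˡ e (bwd (r , p)) = bwd (r , proj₁ (I.role-resp r) e p)

  Adjacent-respʳ : ∀ {x y z} → y I.≈ z → Adjacent I x y → Adjacent I x z
  Adjacent-respʳ e = Adjacent-sym ∘ Adjacent-respˡ e ∘ Adjacent-sym

  Path-respˡ : ∀ {x y z n} → x I.≈ y → Path I x z n → Path I y z n
  Path-respˡ e (stop p)   = stop (I.trans (I.sym e) p)
  Path-respˡ e (step a p) = step (Adjacent-respˡ e a) p

  infixr 5 _++ᴾ_
  _++ᴾ_ : ∀ {x y z m n} → Path I x y m → Path I y z n → Path I x z (m + n)
  stop e   ++ᴾ q = Path-respˡ (I.sym e) q
  step a p ++ᴾ q = step a (p ++ᴾ q)

  edge : ∀ {x y} → Adjacent I x y → Path I x y 1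
  edge a = step a (stop I.refl)

  -- Any path of length at most `k` will do, not only a shortest one, so balls compose by
  -- concatenation. Excluded middle enters only on passing to `N`.
  Ball : ℕ → Rel I.Carrier ℓ
  Ball k x y = ∃[ n ] (Path I x y n × n ≤ k)

  ball-mono : ∀ {j k x y} → j ≤ k → Ball j x y → Ball k x y
  ball-mono j≤k (n , p , n≤j) = n , p , ≤-trans n≤j j≤k

  ball-centre : ∀ {k x} → Ball k x x
  ball-centre = 0 , stop I.refl , z≤n

  ball-trans : ∀ {j k x y z} → Ball j x y → Ball k y z → Ball (j + k) x z
  ball-trans (m , p , m≤j) (n , q , n≤k) = m + n , p ++ᴾ q , +-mono-≤ m≤j n≤k

  ball-snoc : ∀ {j x y z} → Ball j x y → Adjacent I y z → Ball (suc j) x z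
  ball-snoc {j} {x} {z = z} b a = subst (λ m → Ball m x z) (+-comm j 1) (ball-trans b (1 , edge a , ≤-refl))

  N⊆Ball : ∀ {k x y} → N I k x y → Ball k x y
  N⊆Ball (n , (p , _) , n≤k) = n , p , n≤k

  Ball⊆N : ExcludedMiddle ℓ → ∀ {k x y} → Ball k x y → N I k x y
  Ball⊆N em (n , p , n≤k) with m , m≤n , q , least ← minimum em (Path I _ _) p =
    m , (q , least) , ≤-trans m≤n n≤k

-- Colour-preserving homomorphisms on balls.

module _ (em : ExcludedMiddle ℓ) {NC NR C : Set ℓ}
         (I : Interpretation NC NR) (κ : Colouring I C) where
  private
    module I = Interpretation I
    κ⟨_⟩ = Func.to κ

    dom : I.Carrier → Set ℓ
    dom x = _∈dom_ {NC = NC} {NR = NR} x κ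

  -- Unlike a NeighbourhoodMap, a Local forgets that its image lies in N_m(v).
  record Local (m : ℕ) (u v : I.Carrier) : Set ℓ where
    field
      to           : ∀ {z} → Ball I m u z → I.Carrier
      to-cong      : ∀ {z z′} (b : Ball I m u z) (b′ : Ball I m u z′) → z I.≈ z′ → to b I.≈ to b′
      pres-concept : ∀ A {z} (b : Ball I m u z) → I.concept A z → I.concept A (to b)
      pres-role    : ∀ r {z z′} (b : Ball I m u z) (b′ : Ball I m u z′) →
                     I.role r z z′ → I.role r (to b) (to b′)
      pres-colour  : ∀ {z} (b : Ball I m u z) → κ⟨ z ⟩ ≡ κ⟨ to b ⟩
      pres-centre  : (b : Ball I m u u) → to b I.≈ v

    pres-adjacent : ∀ {z z′} (b : Ball I m u z) (b′ : Ball I m u z′) →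
                    Adjacent I z z′ → Adjacent I (to b) (to b′)
    pres-adjacent b b′ (fwd (r , p)) = fwd (r , pres-role r b b′ p)
    pres-adjacent b b′ (bwd (r , p)) = bwd (r , pres-role r b′ b p)

    -- Here `j` bounds the distance from `u` already used, so `j + n ≤ m` keeps every intermediate
    -- vertex in the domain.
    pres-path : ∀ {j n z z′} → Ball I j u z → Path I z z′ n → j + n ≤ m →
                (b : Ball I m u z) (b′ : Ball I m u z′) → Path I (to b) (to b′) n
    pres-path _ (stop e) _ b b′ = stop (to-cong b b′ e)
    pres-path {j} {suc n} c (step {y = y} a p) le b b′ =
      step (pres-adjacent b d a) (pres-path (ball-snoc I c a) p le′ d b′)
      where
      le′ : suc j + n ≤ m
      le′ = subst (_≤ m) (+-suc j n) le
      d : Ball I m u y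
      d = ball-mono I (m+n≤o⇒m≤o (suc j) le′) (ball-snoc I c a)

    -- Recovers the bound on the image: a path from `u` is sent to a path of the same length from
    -- `v`.
    pres-ball : ∀ {j z} → Ball I j u z → j ≤ m → (b : Ball I m u z) → Ball I j v (to b)
    pres-ball (n , p , n≤j) j≤m b =
      n , Path-respˡ I (pres-centre (ball-centre I))
            (pres-path {0} (ball-centre I) p (≤-trans n≤j j≤m) (ball-centre I) b) , n≤j

  open Local

  compose : ∀ {m n u v w} → m ≤ n → Local n u v → Local m v w → Local m u w
  compose {m} {n} {u} {v} m≤n F G = record
    { to           = λ b → G.to (fb b)
    ; to-cong      = λ b b′ e → G.to-cong (fb b) (fb b′) (F.to-cong (up b) (up b′) e)
    ; pres-concept = λ A b → G.pres-concept A (fb b) ∘ F.pres-concept A (up b)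
    ; pres-role    = λ r b b′ → G.pres-role r (fb b) (fb b′) ∘ F.pres-role r (up b) (up b′)
    ; pres-colour  = λ b → trans (F.pres-colour (up b)) (G.pres-colour (fb b))
    ; pres-centre  = λ b → I.trans
        (G.to-cong (fb b) (ball-centre I) (F.pres-centre (up b)))
        (G.pres-centre (ball-centre I))
    }
    where
    module F = Local F
    module G = Local G
    up : ∀ {z} → Ball I m u z → Ball I n u z
    up = ball-mono I m≤n
    fb : ∀ {z} (b : Ball I m u z) → Ball I m v (F.to (up b))
    fb b = F.pres-ball b m≤n (up b)

  -- By the triangle inequality the `m`-ball about `z` lies in the `n`-ball about `u`, so `F`
  -- restricts to it.
  recentre : ∀ {j m n u v z} → j + m ≤ n → (F : Local n u v) →
             Ball I j u z → (b : Ball I n u z) → Local m z (to F b)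
  recentre {j} {m} {n} {u} {z = z} le F c b = record
    { to           = F.to ∘ up
    ; to-cong      = λ d d′ → F.to-cong (up d) (up d′)
    ; pres-concept = λ A d → F.pres-concept A (up d)
    ; pres-role    = λ r d d′ → F.pres-role r (up d) (up d′)
    ; pres-colour  = F.pres-colour ∘ up
    ; pres-centre  = λ d → F.to-cong (up d) b I.refl
    }
    where
    module F = Local F
    up : ∀ {y} → Ball I m z y → Ball I n u y
    up d = ball-mono I le (ball-trans I c d)

  ∈dom-resp : ∀ {x y} → κ⟨ x ⟩ ≡ κ⟨ y ⟩ → dom x → dom y
  ∈dom-resp e d rewrite e = d

  preserved-colour : ∀ {x y} → (dom x ⇔ dom y) → (dom x → κ⟨ x ⟩ ≡ κ⟨ y ⟩) → κ⟨ x ⟩ ≡ κ⟨ y ⟩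
  preserved-colour {x} {y} iff eq with κ⟨ x ⟩ | κ⟨ y ⟩
  ... | just _  | _       = eq (just _)
  ... | nothing | nothing = refl
  ... | nothing | just _  with () ← Equivalence.from iff (just _)

  neighbourhoodMap⇒Local : ∀ {k x y} → NeighbourhoodMap I κ k x y → Local k x y
  neighbourhoodMap⇒Local (h , colours , centred) = record
    { to           = λ b → proj₁ (H.to (_ , Ball⊆N I em b))
    ; to-cong      = λ _ _ → H.cong
    ; pres-concept = λ A _ → H.pres-concept A
    ; pres-role    = λ r _ _ → H.pres-role r
    ; pres-colour  = λ b → let (iff , eq) = colours (_ , Ball⊆N I em b) in preserved-colour iff eq
    ; pres-centre  = λ _ → I.trans (H.cong I.refl) centred
    }
    where module H = Hom h

  ≈⇒Local : ∀ {k x y} → x I.≈ y → Local k x y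
  ≈⇒Local e = record
    { to           = λ {z} _ → z
    ; to-cong      = λ _ _ → id
    ; pres-concept = λ _ _ → id
    ; pres-role    = λ _ _ _ → id
    ; pres-colour  = λ _ → refl
    ; pres-centre  = λ _ → e
    }

  Sim⇒Local : ∀ {k x y} → Sim I κ k x y → Local k x y
  Sim⇒Local (inj₁ e)                   = ≈⇒Local e
  Sim⇒Local (inj₂ (_ , _ , _ , f , _)) = neighbourhoodMap⇒Local f

  Sim⇒colour : ∀ {k x y} → Sim I κ k x y → κ⟨ x ⟩ ≡ κ⟨ y ⟩
  Sim⇒colour (inj₁ e)               = Func.cong κ e
  Sim⇒colour (inj₂ (_ , _ , e , _)) = e

  Sim-uncoloured : ∀ {k x y} → ¬ dom x → Sim I κ k x y → x I.≈ y
  Sim-uncoloured _  (inj₁ e)       = e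
  Sim-uncoloured ¬d (inj₂ (d , _)) = ⊥-elim (¬d d)

  -- Lifting a homomorphism from the quotient.

  module Lift (k : ℕ) {K : ℕ} (k+k≤K : k + k ≤ K) (sparse : Sparse I κ K)
              (Q : Interpretation NC NR) {n : ℕ} (card : HasCardinality Q n) (n≤k : n ≤ k)
              (hom : Hom Q (quotient-∼ I κ K)) where
    private
      module Q = Interpretation Q
      module q = Inverse card
      module h = Hom hom
      open IsEquivalence (Sim-isEquivalence I κ K) using () renaming (sym to ∼-sym)
      infix 4 _∼_
      _∼_ = Sim I κ K

    -- The elements of Q are numbered by Fin n, and h₀ i represents the class h(i).
    h₀ : Fin n → I.Carrier
    h₀ i = h.to (q.to i)

    -- The classes generated by `Related` are the connected components of `Q`, those generated by
    -- `Uncoloured` the blobs; a coloured vertex is alone in its class.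
    Related Uncoloured : Rel (Fin n) ℓ
    Related i j    = ∃[ r ] Q.role r (q.to i) (q.to j)
    Uncoloured i j = Related i j × ¬ dom (h₀ i) × ¬ dom (h₀ j)

    abstract
      comps : Transversal (EqClosure Related)
      comps = transversal em (isEquivalence Related)

      blobs : Transversal (EqClosure Uncoloured)
      blobs = transversal em (isEquivalence Uncoloured)

    comp blob : Fin n → Fin n
    comp = rep comps
    blob = rep blobs

    comp-blob : ∀ i → comp (blob i) ≡ comp i
    comp-blob i = rep-unique comps (EqClosure.map proj₁ (rep-related blobs i))

    witnesses : ∀ {i j} → SymClosure Related i j →
                ∃[ x ] ∃[ y ] (h₀ i ∼ x × h₀ j ∼ y × Adjacent I x y)
    witnesses (fwd (r , e)) with x , y , p , q , a ← h.pres-role r e = x , y , p , q , fwd (r , a)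
    witnesses (bwd (r , e)) with x , y , p , q , a ← h.pres-role r e = y , x , q , p , bwd (r , a)

    -- An edge of the quotient is only witnessed by some `x` and `x′` in the two classes.
    -- Precomposing `F` with the map from `x` to `h₀ i` makes it act on that edge; the image of `x′`
    -- is the new element, and recentring there costs one unit of radius.
    advance : ∀ {m i j y} → suc m ≤ K → SymClosure Related i j → Local (suc m) (h₀ i) y →
              ∃[ z ] (Adjacent I y z × Local m (h₀ j) z)
    advance {m} {y = y} m<K e F with x , x′ , p , p′ , a ← witnesses e =
      to F′ b ,
      Adjacent-respˡ I (pres-centre F′ (ball-centre I)) (pres-adjacent F′ (ball-centre I) b a) ,
      compose (<⇒≤ m<K) (Sim⇒Local p′) (recentre ≤-refl F′ (1 , edge I a , ≤-refl) b)
      where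
      F′ : Local (suc m) x y
      F′ = compose m<K (Sim⇒Local (∼-sym p)) F
      b : Ball I (suc m) x x′
      b = 1 , edge I a , s≤s z≤n

    follow : ∀ {m i j y xs} → length xs + m ≤ K → Walk (SymClosure Related) i j xs →
             Local (length xs + m) (h₀ i) y →
             ∃[ z ] (Path I y z (length xs) × Local m (h₀ j) z)
    follow _ [] F = _ , stop I.refl , F
    follow le (e ∷ w) F with z , a , G ← advance le e F
      with z′ , p , H ← follow (<⇒≤ le) w G = z′ , step a p , H

    abstract
      anchor : ∀ i → ∃[ z ] (Ball I k (h₀ (comp i)) z × Local k (h₀ i) z)
      anchor i with xs , w , l ← short-walk (rep-related comps i)
        with len≤k ← ≤-trans (<⇒≤ l) n≤k
        with le ← ≤-trans (+-monoˡ-≤ k len≤k) k+k≤K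
        -- The walk starts with the identity on the ball about `h₀ (comp i)`; of its radius
        -- `length xs + k`, at most `K`, the part `k` is left at the end.
        with z , p , F ← follow le w (≈⇒Local I.refl) = z , (_ , p , len≤k) , F

    -- Uncoloured classes are singletons, so the witnesses of the edge are `h₀ i` and `h₀ j`
    -- themselves.
    uncoloured-adjacent : ∀ {i j} → SymClosure Uncoloured i j → Adjacent I (h₀ i) (h₀ j)
    uncoloured-adjacent e with witnesses (SymClosure.map proj₁ e) | both e
      where
      both : ∀ {i j} → SymClosure Uncoloured i j → ¬ dom (h₀ i) × ¬ dom (h₀ j)
      both (fwd (_ , d , d′)) = d , d′
      both (bwd (_ , d , d′)) = d′ , d
    ... | x , y , p , p′ , a | d , d′ =
      Adjacent-respˡ I (I.sym (Sim-uncoloured d p)) (Adjacent-respʳ I (I.sym (Sim-uncoloured d′ p′)) a)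

    uncoloured-path : ∀ {i j xs} → Walk (SymClosure Uncoloured) i j xs →
                      Path I (h₀ i) (h₀ j) (length xs)
    uncoloured-path []      = stop I.refl
    uncoloured-path (e ∷ w) = step (uncoloured-adjacent e) (uncoloured-path w)

    abstract
      -- The strict bound matters: it leaves radius 1 around `h₀ i` for `g-local`, and one more edge
      -- within `k + k` after `g-near`.
      blob-ball : ∀ i → ∃[ m ] (m < k × Ball I m (h₀ (blob i)) (h₀ i))
      blob-ball i with xs , w , l ← short-walk (rep-related blobs i) =
        length xs , ≤-trans l n≤k , length xs , uncoloured-path w , ≤-refl

    blob-ball′ : ∀ i → Ball I k (h₀ (blob i)) (h₀ i)
    blob-ball′ i = let (m , m<k , b) = blob-ball i in ball-mono I (<⇒≤ m<k) b

    anchorMap : ∀ i → Local k (h₀ i) _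
    anchorMap i = proj₂ (proj₂ (anchor i))

    -- One map serves the whole blob. For a coloured vertex, alone in its blob, the value is its own
    -- anchor up to `≈`.
    g : Fin n → I.Carrier
    g i = to (anchorMap (blob i)) (blob-ball′ i)

    g-local : ∀ i → Local 1 (h₀ i) (g i)
    g-local i = let (m , m<k , b) = blob-ball i in
      recentre (subst (_≤ k) (+-comm 1 m) m<k) (anchorMap (blob i)) b (blob-ball′ i)

    g-near : ∀ i → ∃[ m ] (m < k + k × Ball I m (h₀ (comp i)) (g i))
    g-near i = let (m , m<k , b) = blob-ball i in
      k + m , +-monoʳ-< k m<k ,
      subst (λ c → Ball I (k + m) (h₀ c) (g i)) (comp-blob i)
        (ball-trans I (proj₁ (proj₂ (anchor (blob i))))
          (pres-ball (anchorMap (blob i)) b (<⇒≤ m<k) (blob-ball′ i)))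

    g-colour : ∀ i → κ⟨ h₀ i ⟩ ≡ κ⟨ g i ⟩
    g-colour i = pres-colour (anchorMap (blob i)) (blob-ball′ i)

    uncoloured-role : ∀ {i j} r → blob i ≡ blob j →
                      I.role r (h₀ i) (h₀ j) → I.role r (g i) (g j)
    -- Abstracting over the representatives lets their equality be matched, after which both values
    -- come from one local map.
    uncoloured-role {i} {j} r eq = go (blob-ball′ i) (blob-ball′ j) eq
      where
      go : ∀ {s t x y} (b : Ball I k (h₀ s) x) (b′ : Ball I k (h₀ t) y) → s ≡ t →
           I.role r x y → I.role r (to (anchorMap s) b) (to (anchorMap t) b′)
      go b b′ refl = pres-role (anchorMap _) r b b′

    around : ∀ {j y} → h₀ j ∼ y → Local 1 y (g j)
    around {j} p = compose 1≤K (Sim⇒Local (∼-sym p)) (g-local j)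
      where
      1≤K : 1 ≤ K
      -- The vertex `j` exists, which excludes `k = 0`.
      1≤K with _ , m<2k , _ ← g-near j = ≤-trans (s≤s z≤n) (≤-trans m<2k k+k≤K)

    -- Both elements carry the colour of `h₀ i` and lie within `K` of `h₀ (comp i)`: the first is
    -- one edge away from `g j`, which is at distance below `k + k`. Sparsity then forbids them to
    -- differ.
    coloured-neighbour : ∀ {i j x y} → comp i ≡ comp j → (p : h₀ i ∼ x) (p′ : h₀ j ∼ y) →
                         Adjacent I y x → dom (h₀ i) → (b : Ball I 1 y x) → to (around p′) b I.≈ g i
    coloured-neighbour {i} {j} {x} {y} same p p′ a d b =
      decidable-stable em λ ≉ → sparse (h₀ (comp i)) w (g i) near-w near-g
        (∈dom-resp (sym w-colour) (∈dom-resp (g-colour i) d)) (∈dom-resp (g-colour i) d) ≉ w-colour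
      where
      F = around p′
      w = to F b
      w-colour : κ⟨ w ⟩ ≡ κ⟨ g i ⟩
      w-colour = trans (sym (pres-colour F b)) (trans (sym (Sim⇒colour p)) (g-colour i))
      near-g : N I K (h₀ (comp i)) (g i)
      near-g = let (m , m<2k , c) = g-near i in
        Ball⊆N I em (ball-mono I (≤-trans (<⇒≤ m<2k) k+k≤K) c)
      near-w : N I K (h₀ (comp i)) w
      near-w = let (m , m<2k , c) = g-near j in
        Ball⊆N I em (subst (λ s → Ball I K (h₀ s) w) (sym same)
        (ball-mono I (≤-trans m<2k k+k≤K) (ball-snoc I c
          (Adjacent-respˡ I (pres-centre F (ball-centre I)) (pres-adjacent F (ball-centre I) b a)))))

    g-concept : ∀ A i → Q.concept A (q.to i) → I.concept A (g i)
    g-concept A i c with x , p , c′ ← h.pres-concept A c =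
      I.concept-resp A (pres-centre (around p) (ball-centre I))
        (pres-concept (around p) A (ball-centre I) c′)

    g-role : ∀ r i j → Q.role r (q.to i) (q.to j) → I.role r (g i) (g j)
    g-role r i j e with x , y , p , p′ , a ← h.pres-role r e | em {dom (h₀ i)} | em {dom (h₀ j)}
    -- The map around `y` sends `y` to `g j` and, since `h₀ i` is coloured, `x` to `g i`; it
    -- therefore carries the edge over.
    ... | yes d | _ =
      proj₂ (I.role-resp r) (coloured-neighbour same p p′ (bwd (r , a)) d b)
        (proj₁ (I.role-resp r) (pres-centre F (ball-centre I)) (pres-role F r b (ball-centre I) a))
      where
      F = around p′
      same = rep-unique comps (fwd (r , e) ◅ ε)
      b = 1 , edge I (bwd (r , a)) , ≤-refl
    ... | no _ | yes d =
      proj₁ (I.role-resp r) (coloured-neighbour same p′ p (fwd (r , a)) d b)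
        (proj₂ (I.role-resp r) (pres-centre F (ball-centre I)) (pres-role F r (ball-centre I) b a))
      where
      F = around p
      same = rep-unique comps (bwd (r , e) ◅ ε)
      b = 1 , edge I (fwd (r , a)) , ≤-refl
    -- The edge joins `h₀ i` and `h₀ j` in `I` already, and `i` and `j` share a blob.
    ... | no d | no d′ =
      uncoloured-role r (rep-unique blobs (fwd ((r , e) , d , d′) ◅ ε))
        (proj₁ (I.role-resp r) (I.sym (Sim-uncoloured d′ p′))
          (proj₂ (I.role-resp r) (I.sym (Sim-uncoloured d p)) a))

    lift : Hom Q I
    lift = record
      { func         = record
          { to   = g ∘ q.from
          ; cong = λ e → I.reflexive (cong g (q.from-cong e))
          }
      ; pres-concept = λ A {x} → g-concept A (q.from x) ∘ Q.concept-resp A (to∘from x)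
      ; pres-role    = λ r {x} {y} → g-role r (q.from x) (q.from y) ∘
          proj₁ (Q.role-resp r) (to∘from y) ∘ proj₂ (Q.role-resp r) (to∘from x)
      }
      where
      to∘from : ∀ x → x Q.≈ q.to (q.from x)
      to∘from x = Q.sym (q.inverseˡ refl)

  -- The converse direction, the bound on the radius, and the equivalence.

  project : ∀ {K} {Q : Interpretation NC NR} → Hom Q I → Hom Q (quotient-∼ I κ K)
  project f = record
    { func         = record { to = f.to ; cong = inj₁ ∘ f.cong }
    ; pres-concept = λ A c → _ , inj₁ I.refl , f.pres-concept A c
    ; pres-role    = λ r e → _ , _ , inj₁ I.refl , inj₁ I.refl , f.pres-role r e
    }
    where module f = Hom f

2k≤2k³ : ∀ k → k + k ≤ 2 * k ^ 3
2k≤2k³ zero      = z≤n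
2k≤2k³ k@(suc _) = +-mono-≤ k≤k³ (≤-trans k≤k³ (m≤m+n (k ^ 3) 0))
  where
  k≤k³ : k ≤ k ^ 3
  k≤k³ = m≤m*n k (k ^ 2) {{m^n≢0 k 2}}

theorem6 : {ℓ : Level} → ExcludedMiddle ℓ →
    {NC NR C : Set ℓ} (k : ℕ) →
    let K = 2 * k ^ 3 in
    (I : Interpretation NC NR) (κ : Colouring I C) → Sparse I κ K →
    (Q : Interpretation NC NR) → (∃[ n ] (HasCardinality Q n × n ≤ k)) →
    Hom Q I ⇔ Hom Q (quotient-∼ I κ K)
theorem6 em k I κ sparse Q (n , card , n≤k) =
  mk⇔ (project em I κ) (Lift.lift em I κ k (2k≤2k³ k) sparse Q card n≤k)
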